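{- Let $\mathbf{f} = (f_n)_{n\ge 1}$ be the ordinary paperfolding word over $\{0,1\}$ and let $\rho(n)$ be its abelian complexity function. Then for all integers $n\ge 0$ (with $n\ge1$ in the first relation) the following hold: \begin{align*} \rho(4n) &= \rho(2n),\\ \rho(4n+2) &= \rho(2n+1)+1,\\ \rho(16n+1) &= \rho(8n+1),\\ \rho(16n+c) &= \rho(2n+1)+2 \quad\text{for each } c\in\{3,7,9,13\},\\ \rho(16n+5) &= \rho(4n+1)+2,\\ \rho(16n+11) &= \rho(4n+3)+2,\\ \rho(16n+15) &= \rho(2n+2)+1. \end{align*}
   Context: The ordinary paperfolding word $\mathbf{f}=(f_n)_{n\ge1}$ over $\{0,1\}$ is defined as follows: for $n\ge 1$ write $n=n'2^k$ with $n'$ odd; then $f_n=0$ if $n'\equiv 1 \pmod 4$ and $f_n=1$ if $n'\equiv 3\pmod 4$. Thus $\mathbf{f}=0010011000110110\cdots$. A factor of $\mathbf{f}$ is a finite contiguous block $f_i f_{i+1}\cdots f_{i+n-1}$. Two words $u,v$ over $\{0,1\}$ are abelian equivalent if one is a rearrangement of the other. For $n\ge1$, the abelian complexity $\rho(n)$ is the number of abelian equivalence classes among the factors of $\mathbf{f}$ of length $n$. -}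

module Defs where

open import Data.Bool.Base using (if_then_else_)
open import Data.Digit using (Bit; 0b; 1b)
open import Data.Fin.Base using (Fin; zero; suc)
import Data.Fin.Properties as Fin
open import Data.List.Base using (List; []; _∷_; _++_; applyUpTo; deduplicate; length; lookup)
open import Data.List.Membership.Propositional.Properties using (∈-∃++; ∈-lookup)
import Data.List.Membership.DecPropositional as DecMembership
import Data.List.Membership.Setoid as SetoidMem
import Data.List.Membership.Setoid.Properties as SetoidMembership
open import Data.List.Relation.Unary.All as All using ([]; _∷_)
open import Data.List.Relation.Unary.AllPairs using ([]; _∷_)
open import Data.List.Relation.Unary.Any as Any using (here; there)
open import Data.List.Relation.Unary.Any.Properties using (lookup-index; applyUpTo⁺)
import Data.List.Relation.Unary.Unique.Setoid as SetoidUnique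
open import Data.List.Relation.Unary.Unique.DecSetoid.Properties using (deduplicate-!)
open import Data.List.Relation.Binary.Permutation.Propositional
  using (_↭_; ↭-refl; ↭-reflexive; ↭-sym; ↭-trans; ↭-prep; ↭-setoid)
open import Data.List.Relation.Binary.Permutation.Propositional.Properties
  using (∈-resp-↭; drop-∷; shift; ↭-empty-inv)
open import Data.Nat.Base
open import Data.Nat.Properties
open import Data.Nat.Divisibility using (_∣_; divides; ∣m+n∣m⇒∣n; ∣⇒≤; 1∣_)
open import Data.Nat.DivMod
open import Data.Nat.Solver using (module +-*-Solver)
open import Data.Product.Base using (∃; _×_; _,_; proj₁; proj₂)
open import Function.Base using (_∘_)
open import Function.Bundles using (Inverse)
open import Level using (0ℓ)
open import Relation.Binary.Bundles using (Setoid; DecSetoid)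
open import Relation.Binary.Definitions using (DecidableEquality; Decidable; tri<; tri≈; tri>)
import Relation.Binary.Construct.On as On
open import Relation.Binary.PropositionalEquality
open import Relation.Nullary using (¬_; yes; no; contradiction)

-- Halve n while it is even, at most fuel times; fuel n suffices.
strip2 : (fuel n : ℕ) → ℕ
strip2 zero       n = n
strip2 (suc fuel) n = if n % 2 ≡ᵇ 0 then strip2 fuel (n / 2) else n

oddPart : ℕ → ℕ
oddPart n = strip2 n n

-- The word is indexed from 1; the value f 0 is junk and occurs in no Factor.
-- The defining clauses for n = n′ * 2 ^ k are f-≡1mod4 and f-≡3mod4 below.
f : ℕ → Bit
f n = if oddPart n % 4 ≡ᵇ 1 then 0b else 1b

factor : (i n : ℕ) → List Bit
factor i n = applyUpTo (λ j → f (i + j)) n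

Factor : ℕ → Set
Factor n = ∃ λ (w : List Bit) → ∃ λ i → 1 ≤ i × w ≡ factor i n

-- Equality compares only the words, up to rearrangement, not where they occur.
AbelianFactors : ℕ → Setoid 0ℓ 0ℓ
AbelianFactors n = On.setoid {B = Factor n} ↭-setoid proj₁

-- The setoid S has exactly k equivalence classes.
HasClasses : Setoid 0ℓ 0ℓ → ℕ → Set
HasClasses S k = Inverse S (setoid (Fin k))

private
  data Halving : ℕ → Set where
    even : ∀ a → Halving (a * 2)
    odd  : ∀ a → Halving (1 + a * 2)

  halve : ∀ n → Halving n
  halve zero = even 0
  halve (suc n) with halve n
  ... | even a = odd a
  ... | odd a  = even (suc a)

  strip2-double : ∀ g x → strip2 (suc g) (x * 2) ≡ strip2 g x
  strip2-double g x rewrite m*n%n≡0 x 2 {{_}} | m*n/n≡m x 2 {{_}} = refl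

  strip2-odd : ∀ g x → x % 2 ≡ 1 → strip2 g x ≡ x
  strip2-odd zero    x eq = refl
  strip2-odd (suc g) x eq rewrite eq = refl

  1+a*2%2 : ∀ a → (1 + a * 2) % 2 ≡ 1
  1+a*2%2 a = [m+kn]%n≡m%n 1 a 2

  strip2-suc : ∀ g n → n ≤ g → strip2 (suc g) n ≡ strip2 g n
  strip2-suc zero    .zero z≤n = refl
  strip2-suc (suc g) n n≤1+g with halve n
  ... | odd a = trans (strip2-odd (2+ g) (1 + a * 2) (1+a*2%2 a))
                      (sym (strip2-odd (suc g) (1 + a * 2) (1+a*2%2 a)))
  ... | even a = trans (strip2-double (suc g) a)
                   (trans (strip2-suc g a (a≤g a n≤1+g)) (sym (strip2-double g a)))
    where
    a≤g : ∀ a → a * 2 ≤ suc g → a ≤ g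
    a≤g zero    _       = z≤n
    a≤g (suc a) (s≤s p) = ≤-trans (s≤s (m≤m*n a 2)) p

  strip2-fuel : ∀ d n → strip2 (d + n) n ≡ strip2 n n
  strip2-fuel zero    n = refl
  strip2-fuel (suc d) n = trans (strip2-suc (d + n) n (m≤n+m n d)) (strip2-fuel d n)

  oddPart-double : ∀ x → oddPart (x * 2) ≡ oddPart x
  oddPart-double zero    = refl
  oddPart-double (suc y) = begin
    strip2 (2+ (y * 2)) (suc y * 2) ≡⟨ strip2-double (suc (y * 2)) (suc y) ⟩
    strip2 (suc (y * 2)) (suc y)    ≡⟨ cong (λ g → strip2 g (suc y)) (fuel y) ⟩
    strip2 (y + suc y) (suc y)      ≡⟨ strip2-fuel y (suc y) ⟩
    strip2 (suc y) (suc y)          ∎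
    where
    open ≡-Reasoning
    open +-*-Solver
    fuel : ∀ y → suc (y * 2) ≡ y + suc y
    fuel = solve 1 (λ y → con 1 :+ y :* con 2 := y :+ (con 1 :+ y)) refl

  oddPart-odd : ∀ n → n % 2 ≡ 1 → oddPart n ≡ n
  oddPart-odd n = strip2-odd n n

  n%2≡n%4%2 : ∀ n → n % 2 ≡ n % 4 % 2
  n%2≡n%4%2 n = begin
    n % 2                       ≡⟨ cong (_% 2) (m≡m%n+[m/n]*n n 4) ⟩
    (n % 4 + n / 4 * 4) % 2     ≡⟨ cong (λ z → (n % 4 + z) % 2) (*-assoc (n / 4) 2 2) ⟨
    (n % 4 + n / 4 * 2 * 2) % 2 ≡⟨ [m+kn]%n≡m%n (n % 4) (n / 4 * 2) 2 ⟩
    n % 4 % 2                   ∎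
    where open ≡-Reasoning

f-double : ∀ n → f (n * 2) ≡ f n
f-double n = cong (λ m → if m % 4 ≡ᵇ 1 then 0b else 1b) (oddPart-double n)

f-odd : ∀ n → n % 2 ≡ 1 → f n ≡ (if n % 4 ≡ᵇ 1 then 0b else 1b)
f-odd n eq = cong (λ m → if m % 4 ≡ᵇ 1 then 0b else 1b) (oddPart-odd n eq)

f-scale : ∀ k n → f (n * 2 ^ k) ≡ f n
f-scale zero    n = cong f (*-identityʳ n)
f-scale (suc k) n = begin
  f (n * (2 * 2 ^ k)) ≡⟨ cong f (trans (cong (n *_) (*-comm 2 (2 ^ k))) (sym (*-assoc n (2 ^ k) 2))) ⟩
  f (n * 2 ^ k * 2)   ≡⟨ f-double (n * 2 ^ k) ⟩
  f (n * 2 ^ k)       ≡⟨ f-scale k n ⟩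
  f n                 ∎
  where open ≡-Reasoning

f-≡1mod4 : ∀ n′ k → n′ % 4 ≡ 1 → f (n′ * 2 ^ k) ≡ 0b
f-≡1mod4 n′ k eq = trans (f-scale k n′)
  (trans (f-odd n′ (trans (n%2≡n%4%2 n′) (cong (_% 2) eq)))
         (cong (λ r → if r ≡ᵇ 1 then 0b else 1b) eq))

f-≡3mod4 : ∀ n′ k → n′ % 4 ≡ 3 → f (n′ * 2 ^ k) ≡ 1b
f-≡3mod4 n′ k eq = trans (f-scale k n′)
  (trans (f-odd n′ (trans (n%2≡n%4%2 n′) (cong (_% 2) eq)))
         (cong (λ r → if r ≡ᵇ 1 then 0b else 1b) eq))

private
  -- f is 2^(k+1)-periodic off the multiples of 2^k.
  f-periodic : ∀ k m t → ¬ (2 ^ k ∣ m) → f (m + t * 2 ^ suc k) ≡ f m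
  f-periodic zero    m t ∤m = contradiction (1∣ m) ∤m
  f-periodic (suc k) m t ∤m with halve m
  ... | even a = begin
    f (a * 2 + t * (2 * 2 ^ suc k)) ≡⟨ cong f (regroup a t (2 ^ suc k)) ⟩
    f ((a + t * 2 ^ suc k) * 2)     ≡⟨ f-double (a + t * 2 ^ suc k) ⟩
    f (a + t * 2 ^ suc k)           ≡⟨ f-periodic k a t ∤a ⟩
    f a                             ≡⟨ f-double a ⟨
    f (a * 2)                       ∎
    where
    open ≡-Reasoning
    open +-*-Solver
    regroup : ∀ a t p → a * 2 + t * (2 * p) ≡ (a + t * p) * 2
    regroup = solve 3 (λ a t p → a :* con 2 :+ t :* (con 2 :* p) := (a :+ t :* p) :* con 2) refl
    ∤a : ¬ (2 ^ k ∣ a)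
    ∤a (divides c eq) = ∤m (divides c (trans (cong (_* 2) eq)
                          (trans (*-assoc c (2 ^ k) 2) (cong (c *_) (*-comm (2 ^ k) 2)))))
  ... | odd a = begin
    f (1 + a * 2 + t * (2 * (2 * 2 ^ k))) ≡⟨ cong f (regroup4 a t (2 ^ k)) ⟩
    f (1 + a * 2 + t * 2 ^ k * 4)         ≡⟨ f-odd (1 + a * 2 + t * 2 ^ k * 4) odd′ ⟩
    bit ((1 + a * 2 + t * 2 ^ k * 4) % 4) ≡⟨ cong bit ([m+kn]%n≡m%n (1 + a * 2) (t * 2 ^ k) 4) ⟩
    bit ((1 + a * 2) % 4)                 ≡⟨ f-odd (1 + a * 2) (1+a*2%2 a) ⟨
    f (1 + a * 2)                         ∎
    where
    open ≡-Reasoning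
    open +-*-Solver
    bit : ℕ → Bit
    bit r = if r ≡ᵇ 1 then 0b else 1b
    regroup4 : ∀ a t p → 1 + a * 2 + t * (2 * (2 * p)) ≡ 1 + a * 2 + t * p * 4
    regroup4 = solve 3 (λ a t p → con 1 :+ a :* con 2 :+ t :* (con 2 :* (con 2 :* p))
                                := con 1 :+ a :* con 2 :+ t :* p :* con 4) refl
    regroup2 : ∀ a x → 1 + a * 2 + x * 4 ≡ 1 + (a + x * 2) * 2
    regroup2 = solve 2 (λ a x → con 1 :+ a :* con 2 :+ x :* con 4
                              := con 1 :+ (a :+ x :* con 2) :* con 2) refl
    odd′ : (1 + a * 2 + t * 2 ^ k * 4) % 2 ≡ 1
    odd′ = trans (cong (_% 2) (regroup2 a (t * 2 ^ k))) (1+a*2%2 (a + t * 2 ^ k * 2))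

  -- Every q agrees in parity and in f-value with one of 1, 2, 3, 6.
  record Representative (q : ℕ) : Set where
    field
      q′ t t′ : ℕ
      1≤q′    : 1 ≤ q′
      q′≤6    : q′ ≤ 6
      same-f  : f q′ ≡ f q
      same-2  : q + t * 2 ≡ q′ + t′ * 2

  representative : ∀ q → Representative q
  representative q with halve q
  ... | even b with f (b * 2) in eq
  ...   | zero = record { q′ = 2; t = 1; t′ = b; 1≤q′ = s≤s z≤n; q′≤6 = ≤ᵇ⇒≤ 2 6 _
                        ; same-f = sym eq; same-2 = +-comm (b * 2) 2 }
  ...   | suc zero = record { q′ = 6; t = 3; t′ = b; 1≤q′ = s≤s z≤n; q′≤6 = ≤-refl
                            ; same-f = sym eq; same-2 = +-comm (b * 2) 6 }
  representative q | odd b with halve b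
  ...   | even c = record { q′ = 1; t = 0; t′ = c * 2; 1≤q′ = s≤s z≤n; q′≤6 = ≤ᵇ⇒≤ 1 6 _
                          ; same-f = sym (trans (cong f (sym (*-identityʳ (1 + c * 2 * 2))))
                                               (f-≡1mod4 (1 + c * 2 * 2) 0 mod4))
                          ; same-2 = +-identityʳ (1 + c * 2 * 2) }
    where
    mod4 : (1 + c * 2 * 2) % 4 ≡ 1
    mod4 = trans (cong (λ z → (1 + z) % 4) (*-assoc c 2 2)) ([m+kn]%n≡m%n 1 c 4)
  ...   | odd c = record { q′ = 3; t = 0; t′ = c * 2; 1≤q′ = s≤s z≤n; q′≤6 = ≤ᵇ⇒≤ 3 6 _
                         ; same-f = sym (trans (cong f (sym (*-identityʳ (3 + c * 2 * 2))))
                                              (f-≡3mod4 (3 + c * 2 * 2) 0 mod4))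
                         ; same-2 = +-identityʳ (3 + c * 2 * 2) }
    where
    mod4 : (3 + c * 2 * 2) % 4 ≡ 3
    mod4 = trans (cong (λ z → (3 + z) % 4) (*-assoc c 2 2)) ([m+kn]%n≡m%n 3 c 4)

  n<2^n : ∀ n → n < 2 ^ n
  n<2^n zero    = s≤s z≤n
  n<2^n (suc n) = ≤-trans (s≤s (n<2^n n))
    (≤-trans (+-monoˡ-≤ (2 ^ n) (m^n>0 2 n)) (≤-reflexive (cong (2 ^ n +_) (sym (+-identityʳ (2 ^ n))))))

  swap₃ : ∀ x y z → x + y + z ≡ x + z + y
  swap₃ = solve 3 (λ x y z → x :+ y :+ z := x :+ z :+ y) refl
    where open +-*-Solver

  multiples-apart : ∀ p i j d → j < d → d < p → p ∣ i + j → ¬ (p ∣ i + d)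
  multiples-apart p i j d j<d d<p p∣i+j p∣i+d = <⇒≱ d<p (≤-trans p≤e (m∸n≤m d j))
    where
    instance _ = >-nonZero (m<n⇒0<n∸m j<d)
    p≤e : p ≤ d ∸ j
    p≤e = ∣⇒≤ (∣m+n∣m⇒∣n (subst (p ∣_) (trans (cong (i +_) (sym (m+[n∸m]≡n (<⇒≤ j<d))))
                                               (sym (+-assoc i j (d ∸ j)))) p∣i+d) p∣i+j)

  -- Every factor of length at most 2^k starts somewhere in 1 … 6·2^k.
  early : ∀ k i → 1 ≤ i →
          ∃ λ i′ → 1 ≤ i′ × i′ ≤ 6 * 2 ^ k × (∀ j → j < 2 ^ k → f (i + j) ≡ f (i′ + j))
  early k (suc i₀) _ = i′ , 1≤i′ , i′≤ , agree
    where
    instance _ = m^n≢0 2 k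
    p r a d : ℕ
    p = 2 ^ k
    r = i₀ % p
    a = i₀ / p
    d = p ∸ suc r
    i = suc i₀
    r<p : r < p
    r<p = m%n<n i₀ p
    d<p : d < p
    d<p = ∸-monoʳ-< (s≤s z≤n) r<p
    i+d : i + d ≡ suc a * p
    i+d = begin
      suc i₀ + d            ≡⟨ cong (λ z → suc z + d) (m≡m%n+[m/n]*n i₀ p) ⟩
      suc r + a * p + d     ≡⟨ +-assoc (suc r) (a * p) d ⟩
      suc r + (a * p + d)   ≡⟨ cong (suc r +_) (+-comm (a * p) d) ⟩
      suc r + (d + a * p)   ≡⟨ +-assoc (suc r) d (a * p) ⟨
      suc r + d + a * p     ≡⟨ cong (_+ a * p) (m+[n∸m]≡n r<p) ⟩
      p + a * p             ∎
      where open ≡-Reasoning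
    open Representative (representative (suc a))
    i′ : ℕ
    i′ = q′ * p ∸ d
    p≤q′p : p ≤ q′ * p
    p≤q′p = ≤-trans (≤-reflexive (sym (*-identityˡ p))) (*-monoˡ-≤ p 1≤q′)
    d<q′p : d < q′ * p
    d<q′p = <-≤-trans d<p p≤q′p
    1≤i′ : 1 ≤ i′
    1≤i′ = m<n⇒0<n∸m d<q′p
    i′≤ : i′ ≤ 6 * p
    i′≤ = ≤-trans (m∸n≤m (q′ * p) d) (*-monoˡ-≤ p q′≤6)
    i′+d : i′ + d ≡ q′ * p
    i′+d = m∸n+n≡m (<⇒≤ d<q′p)
    shifted : ∀ x y t → x + d ≡ y * p → x + t * (2 * p) + d ≡ (y + t * 2) * p
    shifted x y t eq = begin
      x + t * (2 * p) + d   ≡⟨ swap₃ x (t * (2 * p)) d ⟩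
      x + d + t * (2 * p)   ≡⟨ cong₂ _+_ eq (sym (*-assoc t 2 p)) ⟩
      y * p + t * 2 * p     ≡⟨ *-distribʳ-+ p y (t * 2) ⟨
      (y + t * 2) * p       ∎
      where
      open ≡-Reasoning
    meet : i + t * (2 * p) ≡ i′ + t′ * (2 * p)
    meet = +-cancelʳ-≡ d _ _ (trans (shifted i (suc a) t i+d)
             (trans (cong (_* p) same-2) (sym (shifted i′ q′ t′ i′+d))))
    off : ∀ j → ¬ (p ∣ i + j) → ¬ (p ∣ i′ + j) → f (i + j) ≡ f (i′ + j)
    off j ∤ ∤′ = begin
      f (i + j)                  ≡⟨ f-periodic k (i + j) t ∤ ⟨
      f (i + j + t * (2 * p))    ≡⟨ cong f (swap₃ i j (t * (2 * p))) ⟩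
      f (i + t * (2 * p) + j)    ≡⟨ cong (λ z → f (z + j)) meet ⟩
      f (i′ + t′ * (2 * p) + j)  ≡⟨ cong f (swap₃ i′ (t′ * (2 * p)) j) ⟩
      f (i′ + j + t′ * (2 * p))  ≡⟨ f-periodic k (i′ + j) t′ ∤′ ⟩
      f (i′ + j)                 ∎
      where
      open ≡-Reasoning
    agree : ∀ j → j < p → f (i + j) ≡ f (i′ + j)
    agree j j<p with <-cmp j d
    ... | tri< j<d _ _ = off j
            (λ ∣j → multiples-apart p i j d j<d d<p ∣j (divides (suc a) i+d))
            (λ ∣j → multiples-apart p i′ j d j<d d<p ∣j (divides q′ i′+d))
    ... | tri> _ _ d<j = off j
            (multiples-apart p i d j d<j j<p (divides (suc a) i+d))
            (multiples-apart p i′ d j d<j j<p (divides q′ i′+d))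
    ... | tri≈ _ refl _ = begin
            f (i + d)       ≡⟨ cong f i+d ⟩
            f (suc a * p)   ≡⟨ f-scale k (suc a) ⟩
            f (suc a)       ≡⟨ same-f ⟨
            f q′            ≡⟨ f-scale k q′ ⟨
            f (q′ * p)      ≡⟨ cong f i′+d ⟨
            f (i′ + d)      ∎
      where open ≡-Reasoning

  applyUpTo-cong : ∀ {A : Set} (g h : ℕ → A) n → (∀ j → j < n → g j ≡ h j) →
                   applyUpTo g n ≡ applyUpTo h n
  applyUpTo-cong g h zero    eq = refl
  applyUpTo-cong g h (suc n) eq =
    cong₂ _∷_ (eq 0 (s≤s z≤n)) (applyUpTo-cong (g ∘ suc) (h ∘ suc) n (λ j j<n → eq (suc j) (s≤s j<n)))

  ↭-dec : {A : Set} → DecidableEquality A → Decidable (_↭_ {A = A})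
  ↭-dec _≟ᴬ_ [] []       = yes ↭-refl
  ↭-dec _≟ᴬ_ [] (y ∷ ys) = no λ p → contradiction (↭-empty-inv (↭-sym p)) λ ()
  ↭-dec _≟ᴬ_ (x ∷ xs) ys with DecMembership._∈?_ _≟ᴬ_ x ys
  ... | no x∉ys = no λ p → x∉ys (∈-resp-↭ p (here refl))
  ... | yes x∈ys with ∈-∃++ x∈ys
  ...   | as , bs , refl with ↭-dec _≟ᴬ_ xs (as ++ bs)
  ...     | yes p = yes (↭-trans (↭-prep x p) (↭-sym (shift x as bs)))
  ...     | no ¬p = no λ p → ¬p (drop-∷ (↭-trans p (shift x as bs)))

  module _ (D : DecSetoid 0ℓ 0ℓ) where
    open DecSetoid D using (Carrier; _≈_)
      renaming (setoid to S; _≟_ to _≈?_; refl to ≈-refl; sym to ≈-sym; trans to ≈-trans)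
    open SetoidMem S renaming (_∈_ to _∈ₛ_) using ()
    open SetoidUnique S using (Unique)

    unique⇒lookup-injective : ∀ {xs} → Unique xs → ∀ i j → lookup xs i ≈ lookup xs j → i ≡ j
    unique⇒lookup-injective (_ ∷ _)  zero    zero    _  = refl
    unique⇒lookup-injective (x∉ ∷ _) zero    (suc j) eq = contradiction eq (All.lookup x∉ (∈-lookup j))
    unique⇒lookup-injective (x∉ ∷ _) (suc i) zero    eq = contradiction (≈-sym eq) (All.lookup x∉ (∈-lookup i))
    unique⇒lookup-injective (_ ∷ u)  (suc i) (suc j) eq = cong suc (unique⇒lookup-injective u i j eq)

    covered⇒classes : ∀ xs → (∀ x → x ∈ₛ xs) → ∃ (HasClasses S)
    covered⇒classes xs cover = length ys , record
      { to        = to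
      ; from      = lookup ys
      ; to-cong   = λ {x} {y} x≈y → inj (to x) (to y)
                      (≈-trans (≈-sym (spec x)) (≈-trans x≈y (spec y)))
      ; from-cong = λ { refl → ≈-refl }
      ; inverse   = (λ {i} {x} x≈i → inj (to x) i (≈-trans (≈-sym (spec x)) x≈i))
                  , (λ { {x} refl → ≈-sym (spec x) })
      }
      where
      ys = deduplicate _≈?_ xs
      x∈ys : ∀ x → x ∈ₛ ys
      x∈ys x = SetoidMembership.∈-deduplicate⁺ S _≈?_ (λ z≈y x≈y → ≈-trans x≈y (≈-sym z≈y)) (cover x)
      to : Carrier → Fin (length ys)
      to x = Any.index (x∈ys x)
      spec : ∀ x → x ≈ lookup ys (to x)
      spec x = lookup-index (x∈ys x)
      inj = unique⇒lookup-injective (deduplicate-! D xs)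

  AbelianFactorsᵈ : ℕ → DecSetoid 0ℓ 0ℓ
  AbelianFactorsᵈ n = record
    { isDecEquivalence = record
      { isEquivalence = Setoid.isEquivalence (AbelianFactors n)
      ; _≟_           = λ u v → ↭-dec Fin._≟_ (proj₁ u) (proj₁ v)
      }
    }

abstract
  abelianFactors-finite : ∀ n → ∃ (HasClasses (AbelianFactors n))
  abelianFactors-finite n = covered⇒classes (AbelianFactorsᵈ n) (applyUpTo start (6 * 2 ^ n)) cover
    where
    start : ℕ → Factor n
    start i = factor (suc i) n , suc i , s≤s z≤n , refl
    cover : (w : Factor n) → Any.Any (λ (v : Factor n) → proj₁ w ↭ proj₁ v) (applyUpTo start (6 * 2 ^ n))
    cover (w , i , 1≤i , refl) with early n i 1≤i
    ... | suc i₀ , _ , i₀< , agree = applyUpTo⁺ start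
      (↭-reflexive (applyUpTo-cong _ _ n (λ j j<n → agree j (<-trans j<n (n<2^n n))))) i₀<

-- The abelian complexity; its specification is ρ-classes, which determines it.
ρ : ℕ → ℕ
ρ n = proj₁ (abelianFactors-finite n)

ρ-classes : ∀ n → HasClasses (AbelianFactors n) (ρ n)
ρ-classes n = proj₂ (abelianFactors-finite n)

module Submission where

open import Defs
open import Data.Digit using (Bit; 0b; 1b)
open import Data.Fin.Base as Fin using (Fin; zero; suc; toℕ; fromℕ<)
open import Data.Fin.Permutation using (↔⇒≡)
import Data.Fin.Properties as Finₚ
import Data.Integer.Base as ℤ
open import Data.Integer.Base using (ℤ; +_; 0ℤ; 1ℤ; -1ℤ; -_; _≤_) renaming (suc to sucℤ; pred to predℤ)
open import Data.Integer.Properties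
open import Data.Integer.Tactic.RingSolver using (solve-∀)
open import Data.List using ([]; _∷_)
open import Data.List.Base using (List; _++_; map; length; replicate; applyUpTo; allFin)
import Data.List.Extrema.Nat as Extrema
open import Data.List.Membership.Propositional using (_∈_)
open import Data.List.Membership.Propositional.Properties using (∈-allFin)
open import Data.List.Properties using (length-applyUpTo)
open import Data.List.Relation.Binary.Permutation.Propositional
  using (_↭_; ↭-refl; ↭-reflexive; ↭-sym; ↭-trans; ↭-prep)
open import Data.List.Relation.Binary.Permutation.Propositional.Properties using (map⁺; shift)
import Data.List.Relation.Unary.All as All
open import Data.List.Relation.Unary.Any using (here; there)
open import Data.Nat using (ℕ; _+_; _*_; _≥_)
open import Data.Nat.Base as ℕ using (zero; suc)
open import Data.Nat.DivMod using (_%_)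
open import Data.Nat.ListAction using (sum)
open import Data.Nat.ListAction.Properties using (sum-↭)
import Data.Nat.Properties as ℕₚ
import Data.Nat.Tactic.RingSolver as ℕ-Solver
open import Data.Product using (_×_)
open import Data.Product.Base using (∃; ∃₂; _,_; proj₁; proj₂)
open import Data.Sum.Base using (_⊎_; inj₁; inj₂)
open import Function.Base using (_∘_)
open import Function.Bundles using (Inverse)
import Function.Construct.Composition as Compose
import Function.Construct.Symmetry as Symmetry
open import Relation.Binary.PropositionalEquality
open import Relation.Nullary using (contradiction)

-- Write the word with letters ±1 and let D n be the largest sum over a window of
-- length n.  Shifting a window by one place changes its number of ones by at most
-- one, so the abelian classes correspond to an interval of counts, and 2 ρ n - 2 is
-- D n for the word plus D n for its negation.  A window splits into an alternating
-- half and another half that is again a window of the word; this relates the window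
-- sums of lengths 2N and 2N + 1 to those of lengths N and N + 1, up to a sign that
-- depends on the parity of the starting position.  The recurrences for D follow from
-- bounding these signs above and from choosing the starting position that realises
-- them, whatever the first sign of the alternating half is; so they hold for the
-- word and for its negation.

-- Signs, folded sequences and window sums.

data Parity : ℕ → Set where
  even : ∀ a → Parity (a * 2)
  odd  : ∀ a → Parity (1 + a * 2)

parity : ∀ n → Parity n
parity zero = even 0
parity (suc n) with parity n
... | even a = odd a
... | odd a  = even (suc a)

IsUnit : ℤ → Set
IsUnit u = u ≡ 1ℤ ⊎ u ≡ -1ℤ

neg-unit : ∀ {u} → IsUnit u → IsUnit (- u)
neg-unit (inj₁ refl) = inj₂ refl
neg-unit (inj₂ refl) = inj₁ refl

unit+x≤1+x : ∀ {u} → IsUnit u → ∀ x → u ℤ.+ x ≤ sucℤ x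
unit+x≤1+x (inj₁ refl) x = ≤-refl
unit+x≤1+x (inj₂ refl) x = i≤j⇒pred[i]≤j (i≤suc[i] x)

x≤1+unit+x : ∀ {u} → IsUnit u → ∀ x → x ≤ sucℤ (u ℤ.+ x)
x≤1+unit+x (inj₁ refl) x = i≤j⇒i≤1+j (i≤suc[i] x)
x≤1+unit+x (inj₂ refl) x = ≤-reflexive (sym (suc-pred x))

+-swap : ∀ x y z → x ℤ.+ (y ℤ.+ z) ≡ y ℤ.+ (x ℤ.+ z)
+-swap = solve-∀

+-interchange : ∀ w x y z → w ℤ.+ (x ℤ.+ (y ℤ.+ z)) ≡ w ℤ.+ y ℤ.+ (x ℤ.+ z)
+-interchange = solve-∀

u-u+x≡x : ∀ u x → u ℤ.+ (- u ℤ.+ x) ≡ x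
u-u+x≡x = solve-∀

-u+u+x≡x : ∀ u x → - u ℤ.+ (u ℤ.+ x) ≡ x
-u+u+x≡x = solve-∀

alternating : ℤ → ℕ → ℤ
alternating ε zero    = ε
alternating ε (suc a) = - alternating ε a

alternating-shift : ∀ ε q a → alternating ε (q * 2 + a) ≡ alternating ε a
alternating-shift ε zero    a = refl
alternating-shift ε (suc q) a = trans (neg-involutive _) (alternating-shift ε q a)

-- The Toeplitz construction of the ordinary paperfolding sequence, indexed from 0. The clauses
-- determine `h` from its first letter `ε`, which is left open.
record Folded (h : ℕ → ℤ) : Set where
  field
    ε      : ℤ
    ε-unit : IsUnit ε
    h-even : ∀ a → h (a * 2) ≡ alternating ε a
    h-odd  : ∀ a → h (1 + a * 2) ≡ h a
    h-unit : ∀ j → IsUnit (h j)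

windowSum : (ℕ → ℤ) → ℕ → ℕ → ℤ
windowSum h j zero    = 0ℤ
windowSum h j (suc n) = h j ℤ.+ windowSum h (suc j) n

-- A record rather than a bare function type, so that the length and the bound can be read off by
-- unification although `windowSum` computes.
record Upper (h : ℕ → ℤ) (n : ℕ) (d : ℤ) : Set where
  field bound : ∀ j → windowSum h j n ≤ d

open Upper

Lower IsMax : (ℕ → ℤ) → ℕ → ℤ → Set
Lower h n d = ∃ λ j → d ≤ windowSum h j n
IsMax h n d = Upper h n d × Lower h n d

module _ {h : ℕ → ℤ} (F : Folded h) where
  open Folded F

  private
    s = windowSum h
    U = Upper h
    L = Lower h
    sign = alternating ε

  -- Halving a window.

  altSum : ℕ → ℕ → ℤ
  altSum a zero    = 0ℤ
  altSum a (suc N) = sign a ℤ.+ altSum (suc a) N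

  altSum-even : ∀ a k → altSum a (k * 2) ≡ 0ℤ
  altSum-even a zero    = refl
  altSum-even a (suc k) = trans (u-u+x≡x (sign a) _) (altSum-even (2 + a) k)

  altSum-odd : ∀ a k → altSum a (1 + k * 2) ≡ sign a
  altSum-odd a k = trans (cong (λ z → sign a ℤ.+ z) (altSum-even (suc a) k)) (+-identityʳ (sign a))

  -- By `h-even` and `h-odd`, the even positions of a window carry consecutive signs and the odd
  -- ones consecutive letters of `h`. In the four cases, an odd start moves the signs on to `suc a`,
  -- and an odd length gives one more term to the half containing the first position.
  S-even-even : ∀ a N → s (a * 2) (N * 2) ≡ altSum a N ℤ.+ s a N
  S-even-even a zero    = refl
  S-even-even a (suc N)
    rewrite h-even a | h-odd a | S-even-even (suc a) N
    = +-interchange (sign a) (h a) (altSum (suc a) N) (s (suc a) N)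

  S-odd-even : ∀ a N → s (1 + a * 2) (N * 2) ≡ altSum (suc a) N ℤ.+ s a N
  S-odd-even a zero    = refl
  S-odd-even a (suc N)
    rewrite h-odd a | h-even (suc a) | S-odd-even (suc a) N
    = trans (+-swap (h a) (- sign a) _) (+-interchange (- sign a) (h a) (altSum (2 + a) N) (s (suc a) N))

  S-even-odd : ∀ a N → s (a * 2) (1 + N * 2) ≡ altSum a (suc N) ℤ.+ s a N
  S-even-odd a N rewrite h-even a | S-odd-even a N = sym (+-assoc (sign a) (altSum (suc a) N) (s a N))

  S-odd-odd : ∀ a N → s (1 + a * 2) (1 + N * 2) ≡ altSum (suc a) N ℤ.+ s a (suc N)
  S-odd-odd a N rewrite h-odd a | S-even-even (suc a) N = +-swap (h a) (altSum (suc a) N) (s (suc a) N)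

  private
    drop-altSum : ∀ a k x → altSum a (k * 2) ℤ.+ x ≡ x
    drop-altSum a k x = trans (cong (ℤ._+ x) (altSum-even a k)) (+-identityˡ x)

  -- Lengths are written in nested form, such as 1 + (1 + k * 2) * 2 for 4k + 3, so
  -- that the halving lemmas apply without rewriting them.
  S₀-4k : ∀ a k → s (a * 2) (k * 2 * 2) ≡ s a (k * 2)
  S₀-4k a k = trans (S-even-even a (k * 2)) (drop-altSum a k _)

  S₁-4k : ∀ a k → s (1 + a * 2) (k * 2 * 2) ≡ s a (k * 2)
  S₁-4k a k = trans (S-odd-even a (k * 2)) (drop-altSum (suc a) k _)

  S₀-4k+1 : ∀ a k → s (a * 2) (1 + k * 2 * 2) ≡ sign a ℤ.+ s a (k * 2)
  S₀-4k+1 a k = trans (S-even-odd a (k * 2)) (cong (ℤ._+ _) (altSum-odd a k))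

  S₁-4k+1 : ∀ a k → s (1 + a * 2) (1 + k * 2 * 2) ≡ s a (1 + k * 2)
  S₁-4k+1 a k = trans (S-odd-odd a (k * 2)) (drop-altSum (suc a) k _)

  S₀-4k+2 : ∀ a k → s (a * 2) ((1 + k * 2) * 2) ≡ sign a ℤ.+ s a (1 + k * 2)
  S₀-4k+2 a k = trans (S-even-even a (1 + k * 2)) (cong (ℤ._+ _) (altSum-odd a k))

  S₁-4k+2 : ∀ a k → s (1 + a * 2) ((1 + k * 2) * 2) ≡ sign (suc a) ℤ.+ s a (1 + k * 2)
  S₁-4k+2 a k = trans (S-odd-even a (1 + k * 2)) (cong (ℤ._+ _) (altSum-odd (suc a) k))

  S₀-4k+3 : ∀ a k → s (a * 2) (1 + (1 + k * 2) * 2) ≡ s a (1 + k * 2)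
  S₀-4k+3 a k = trans (S-even-odd a (1 + k * 2)) (drop-altSum a (suc k) _)

  S₁-4k+3 : ∀ a k → s (1 + a * 2) (1 + (1 + k * 2) * 2) ≡ sign (suc a) ℤ.+ s a (suc k * 2)
  S₁-4k+3 a k = trans (S-odd-odd a (1 + k * 2)) (cong (ℤ._+ _) (altSum-odd (suc a) k))

  -- Control of signs and of the ends of a window.

  sign-unit : ∀ a → IsUnit (sign a)
  sign-unit zero    = ε-unit
  sign-unit (suc a) = neg-unit (sign-unit a)

  sign-even : ∀ a → sign (a * 2) ≡ ε
  sign-even a = trans (cong sign (sym (ℕₚ.+-identityʳ (a * 2)))) (alternating-shift ε a 0)

  choose-sign : ∀ {u} → IsUnit u → ∀ a → sign a ≡ u ⊎ sign (suc a) ≡ u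
  choose-sign (inj₁ refl) a with sign-unit a
  ... | inj₁ eq = inj₁ eq
  ... | inj₂ eq = inj₂ (cong -_ eq)
  choose-sign (inj₂ refl) a with sign-unit a
  ... | inj₁ eq = inj₂ (cong -_ eq)
  ... | inj₂ eq = inj₁ eq

  S-suc≤ : ∀ j n → s j (suc n) ≤ sucℤ (s (suc j) n)
  S-suc≤ j n = unit+x≤1+x (h-unit j) _

  ≤S-suc : ∀ j n → s (suc j) n ≤ sucℤ (s j (suc n))
  ≤S-suc j n = x≤1+unit+x (h-unit j) _

  S-snoc≤ : ∀ j n → s j (suc n) ≤ sucℤ (s j n)
  S-snoc≤ j zero    = unit+x≤1+x (h-unit j) 0ℤ
  S-snoc≤ j (suc n) = ≤-trans (+-monoʳ-≤ (h j) (S-snoc≤ (suc j) n)) (≤-reflexive (+-swap (h j) 1ℤ _))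

  ≤S-snoc : ∀ j n → s j n ≤ sucℤ (s j (suc n))
  ≤S-snoc j zero    = x≤1+unit+x (h-unit j) 0ℤ
  ≤S-snoc j (suc n) = ≤-trans (+-monoʳ-≤ (h j) (≤S-snoc (suc j) n)) (≤-reflexive (+-swap (h j) 1ℤ _))

  -- If an even shift `P` preserves the first `N` letters, then `P * 2` preserves one more: even
  -- positions see only the parity of `P + a`, and odd positions halve to the shift `P`. A positive
  -- shift leaves a letter in front of the new occurrence, and an even one preserves the signs of
  -- starting positions.
  prefix-recurs : ∀ N → ∃ λ p → ∀ j → j ℕ.< N → h (suc p * 2 + j) ≡ h j
  prefix-recurs zero    = 0 , λ _ ()
  prefix-recurs (suc N) with prefix-recurs N
  -- With this witness, `suc (1 + p * 2) * 2` computes to `P * 2`.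
  ... | p , recur = 1 + p * 2 , recur′
    where
    P = suc p * 2
    double : ∀ a → (P + a) * 2 ≡ P * 2 + a * 2
    double a = ℕₚ.*-distribʳ-+ 2 P a
    recur′ : ∀ j → j ℕ.< suc N → h (P * 2 + j) ≡ h j
    recur′ j j<1+N with parity j
    ... | even a = begin
      h (P * 2 + a * 2) ≡⟨ cong h (double a) ⟨
      h ((P + a) * 2)   ≡⟨ h-even (P + a) ⟩
      sign (P + a)      ≡⟨ alternating-shift ε (suc p) a ⟩
      sign a            ≡⟨ h-even a ⟨
      h (a * 2)         ∎
      where open ≡-Reasoning
    ... | odd a = begin
      h (P * 2 + (1 + a * 2)) ≡⟨ cong h (ℕₚ.+-suc (P * 2) (a * 2)) ⟩
      h (1 + (P * 2 + a * 2)) ≡⟨ cong (λ z → h (suc z)) (double a) ⟨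
      h (1 + (P + a) * 2)     ≡⟨ h-odd (P + a) ⟩
      h (P + a)               ≡⟨ recur a (ℕₚ.≤-<-trans (ℕₚ.m≤m*n a 2) (ℕ.s≤s⁻¹ j<1+N)) ⟩
      h a                     ≡⟨ h-odd a ⟨
      h (1 + a * 2)           ∎
      where open ≡-Reasoning

  S-shift : ∀ P j n → (∀ i → i ℕ.< j + n → h (P + i) ≡ h i) → s (P + j) n ≡ s j n
  S-shift P j zero    eq = refl
  S-shift P j (suc n) eq = cong₂ ℤ._+_ (eq j (ℕₚ.m<m+n j ℕ.z<s))
    (trans (cong (λ z → s z n) (sym (ℕₚ.+-suc P j)))
           (S-shift P (suc j) n (λ i i< → eq i (subst (i ℕ.<_) (sym (ℕₚ.+-suc j n)) i<))))

  -- When j has the wrong sign the window is extended to the left instead, at a later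
  -- occurrence of it, because nothing precedes position 0.
  extend : ∀ {u} → IsUnit u → ∀ j n → ∃ λ c → sign c ≡ u × s j n ≤ sucℤ (s c (suc n))
  extend u± j n with choose-sign u± j
  ... | inj₁ eq = j , eq , ≤S-snoc j n
  ... | inj₂ eq with prefix-recurs (j + n)
  ...   | p , recur = c , trans (cong -_ (alternating-shift ε p j)) eq
                      , subst (_≤ sucℤ (s c (suc n))) (S-shift (suc p * 2) j n recur) (≤S-suc c n)
    where
    -- `suc c` is the later copy of position `j`, so `c` has the sign opposite to that of `j`.
    c = suc (p * 2 + j)

  -- Dropping the last or the first letter leaves windows whose starts have opposite signs.
  restrict : ∀ {u} → IsUnit u → ∀ j n → ∃ λ c → sign c ≡ u × s j (suc n) ≤ sucℤ (s c n)
  restrict u± j n with choose-sign u± j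
  ... | inj₁ eq = j , eq , S-snoc≤ j n
  ... | inj₂ eq = suc j , eq , S-suc≤ j n

  -- Bounds under a single halving.

  weaken : ∀ {n d} → U n d → U n (sucℤ d)
  weaken up .bound j = i≤j⇒i≤1+j (bound up j)

  upper-suc : ∀ {n d} → U n d → U (suc n) (sucℤ d)
  upper-suc {n} up .bound j = ≤-trans (S-suc≤ j n) (suc-mono (bound up (suc j)))

  upper-pred : ∀ {n d} → U (suc n) d → U n (sucℤ d)
  upper-pred {n} up .bound j = ≤-trans (≤S-snoc j n) (suc-mono (bound up j))

  sign+≤ : ∀ a {x d} → x ≤ d → sign a ℤ.+ x ≤ sucℤ d
  sign+≤ a x≤d = ≤-trans (unit+x≤1+x (sign-unit a) _) (suc-mono x≤d)

  upper-4k : ∀ k {d} → U (k * 2) d → U (k * 2 * 2) d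
  upper-4k k up .bound j with parity j
  ... | even a = ≤-trans (≤-reflexive (S₀-4k a k)) (bound up a)
  ... | odd a  = ≤-trans (≤-reflexive (S₁-4k a k)) (bound up a)

  upper-4k+2 : ∀ k {d} → U (1 + k * 2) d → U ((1 + k * 2) * 2) (sucℤ d)
  upper-4k+2 k up .bound j with parity j
  ... | even a = ≤-trans (≤-reflexive (S₀-4k+2 a k)) (sign+≤ a (bound up a))
  ... | odd a  = ≤-trans (≤-reflexive (S₁-4k+2 a k)) (sign+≤ (suc a) (bound up a))

  -- Only even starts pick up a sign, and they halve to the shorter length; this is why the bound
  -- assumed for `k * 2` is smaller by one.
  upper-4k+1 : ∀ k {d} → U (k * 2) d → U (1 + k * 2) (sucℤ d) → U (1 + k * 2 * 2) (sucℤ d)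
  upper-4k+1 k up up′ .bound j with parity j
  ... | even a = ≤-trans (≤-reflexive (S₀-4k+1 a k)) (sign+≤ a (bound up a))
  ... | odd a  = ≤-trans (≤-reflexive (S₁-4k+1 a k)) (bound up′ a)

  upper-4k+3 : ∀ k {d} → U (suc k * 2) d → U (1 + k * 2) (sucℤ d) →
               U (1 + (1 + k * 2) * 2) (sucℤ d)
  upper-4k+3 k up up′ .bound j with parity j
  ... | even a = ≤-trans (≤-reflexive (S₀-4k+3 a k)) (bound up′ a)
  ... | odd a  = ≤-trans (≤-reflexive (S₁-4k+3 a k)) (sign+≤ (suc a) (bound up a))

  -- The starts `b * 2` and `1 + b * 2` give equal sums but have opposite signs. Prescribing the
  -- sign here lets the next halving gain 1.
  lower-4k : ∀ {u} → IsUnit u → ∀ k {d} → L (k * 2) d → ∃ λ a → sign a ≡ u × d ≤ s a (k * 2 * 2)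
  lower-4k u± k (b , d≤) with choose-sign u± (b * 2)
  ... | inj₁ eq = b * 2 , eq , ≤-trans d≤ (≤-reflexive (sym (S₀-4k b k)))
  ... | inj₂ eq = 1 + b * 2 , eq , ≤-trans d≤ (≤-reflexive (sym (S₁-4k b k)))

  1+d≤u+x : ∀ {u} → u ≡ 1ℤ → ∀ {x d} → d ≤ x → sucℤ d ≤ u ℤ.+ x
  1+d≤u+x refl d≤x = suc-mono d≤x

  -- The two starts that halve to `a` contribute opposite signs, so one of them contributes 1.
  lower-4k+2 : ∀ k {d} → L (1 + k * 2) d → L ((1 + k * 2) * 2) (sucℤ d)
  lower-4k+2 k (a , d≤) with choose-sign (inj₁ refl) a
  ... | inj₁ eq = a * 2 , ≤-trans (1+d≤u+x eq d≤) (≤-reflexive (sym (S₀-4k+2 a k)))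
  ... | inj₂ eq = 1 + a * 2 , ≤-trans (1+d≤u+x eq d≤) (≤-reflexive (sym (S₁-4k+2 a k)))

  -- Two halvings at once.

  2+d≤u+v+x : ∀ {p q x d} → p ≡ 1ℤ → q ≡ 1ℤ → d ≤ x → sucℤ (sucℤ d) ≤ p ℤ.+ (q ℤ.+ x)
  2+d≤u+v+x p≡1 q≡1 d≤x = 1+d≤u+x p≡1 (1+d≤u+x q≡1 d≤x)

  cancel : ∀ {p q} → p ≡ - q → ∀ x → p ℤ.+ (q ℤ.+ x) ≡ x
  cancel {q = q} refl x = -u+u+x≡x q x

  sign+sign+≤ : ∀ a b {x d} → x ≤ d → sign a ℤ.+ (sign b ℤ.+ x) ≤ sucℤ (sucℤ d)
  sign+sign+≤ a b x≤d = sign+≤ a (sign+≤ b x≤d)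

  sign-even≡ : ∀ a b → sign (a * 2) ≡ sign (b * 2)
  sign-even≡ a b = trans (sign-even a) (sym (sign-even b))

  -- The two signs cancel for one parity of b and agree for the other.
  private
    8k+3₀ : ∀ b k → s (1 + b * 2 * 2) (1 + (1 + k * 2 * 2) * 2)
                  ≡ - sign (b * 2) ℤ.+ (sign b ℤ.+ s b (1 + k * 2))
    8k+3₀ b k = trans (S₁-4k+3 (b * 2) (k * 2)) (cong (λ z → - sign (b * 2) ℤ.+ z) (S₀-4k+2 b k))

    8k+3₁ : ∀ b k → s (1 + (1 + b * 2) * 2) (1 + (1 + k * 2 * 2) * 2)
                  ≡ sign (suc b * 2) ℤ.+ (- sign b ℤ.+ s b (1 + k * 2))
    8k+3₁ b k = trans (S₁-4k+3 (1 + b * 2) (k * 2)) (cong (λ z → sign (suc b * 2) ℤ.+ z) (S₁-4k+2 b k))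

    8k+5₀ : ∀ b k → s (b * 2 * 2) (1 + (1 + k * 2) * 2 * 2)
                  ≡ sign (b * 2) ℤ.+ (sign b ℤ.+ s b (1 + k * 2))
    8k+5₀ b k = trans (S₀-4k+1 (b * 2) (1 + k * 2)) (cong (λ z → sign (b * 2) ℤ.+ z) (S₀-4k+2 b k))

    8k+5₁ : ∀ b k → s ((1 + b * 2) * 2) (1 + (1 + k * 2) * 2 * 2)
                  ≡ - sign (b * 2) ℤ.+ (- sign b ℤ.+ s b (1 + k * 2))
    8k+5₁ b k = trans (S₀-4k+1 (1 + b * 2) (1 + k * 2)) (cong (λ z → - sign (b * 2) ℤ.+ z) (S₁-4k+2 b k))

  -- Bounding the two signs separately would cost 2 at every start. They add up only when the
  -- twice-halved start `b` is odd, so the sharp bound `d` is asked of odd starts only; elsewhere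
  -- they cancel and `sucℤ (sucℤ d)` suffices.
  upper-8k+3 : ∀ k {d} → U (1 + k * 2 * 2) (sucℤ (sucℤ d)) → U (1 + k * 2) (sucℤ (sucℤ d)) →
               (∀ c → s (1 + c * 2) (1 + k * 2) ≤ d) →
               U (1 + (1 + k * 2 * 2) * 2) (sucℤ (sucℤ d))
  upper-8k+3 k up up′ odd≤ .bound j with parity j
  ... | even y = ≤-trans (≤-reflexive (S₀-4k+3 y (k * 2))) (bound up y)
  ... | odd y with parity y
  ...   | even b with parity b
  ...     | even c = ≤-trans (≤-reflexive (trans (8k+3₀ b k) (cancel (cong -_ (sign-even≡ b c)) _))) (bound up′ b)
  ...     | odd c  = ≤-trans (≤-reflexive (8k+3₀ b k)) (sign+sign+≤ (suc (b * 2)) b (odd≤ c))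
  upper-8k+3 k up up′ odd≤ .bound j | odd y | odd b with parity b
  ...     | even c = ≤-trans (≤-reflexive (trans (8k+3₁ b k)
                       (cancel (trans (sign-even≡ (suc b) c) (sym (neg-involutive _))) _))) (bound up′ b)
  ...     | odd c  = ≤-trans (≤-reflexive (8k+3₁ b k)) (sign+sign+≤ (suc b * 2) (suc b) (odd≤ c))

  -- For odd `b`, the formula `8k+3₁` adds twice `ε` and `8k+3₀` subtracts it; the value of `ε`
  -- decides which start gains 2.
  lower-8k+3 : ∀ k c {d} → d ≤ s (1 + c * 2) (1 + k * 2) →
               L (1 + (1 + k * 2 * 2) * 2) (sucℤ (sucℤ d))
  lower-8k+3 k c d≤ with ε-unit
  ... | inj₁ ε≡1 = _ , ≤-trans (2+d≤u+v+x (trans (sign-even (suc b)) ε≡1)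
                         (trans (neg-involutive _) (trans (sign-even c) ε≡1)) d≤)
                       (≤-reflexive (sym (8k+3₁ b k)))
    where b = 1 + c * 2
  ... | inj₂ ε≡-1 = _ , ≤-trans (2+d≤u+v+x (cong -_ (trans (sign-even b) ε≡-1))
                          (cong -_ (trans (sign-even c) ε≡-1)) d≤)
                        (≤-reflexive (sym (8k+3₀ b k)))
    where b = 1 + c * 2

  -- As for `8k+3`, but here the signs add up exactly when `b` is even.
  upper-8k+5 : ∀ k {d} → U (1 + (1 + k * 2) * 2) (sucℤ (sucℤ d)) → U (1 + k * 2) (sucℤ (sucℤ d)) →
               (∀ c → s (c * 2) (1 + k * 2) ≤ d) →
               U (1 + (1 + k * 2) * 2 * 2) (sucℤ (sucℤ d))
  upper-8k+5 k up up′ even≤ .bound j with parity j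
  ... | odd y = ≤-trans (≤-reflexive (S₁-4k+1 y (1 + k * 2))) (bound up y)
  ... | even y with parity y
  ...   | even b with parity b
  ...     | even c = ≤-trans (≤-reflexive (8k+5₀ b k)) (sign+sign+≤ (b * 2) b (even≤ c))
  ...     | odd c  = ≤-trans (≤-reflexive (trans (8k+5₀ b k)
                       (cancel (trans (sign-even≡ b c) (sym (neg-involutive _))) _))) (bound up′ b)
  upper-8k+5 k up up′ even≤ .bound j | even y | odd b with parity b
  ...     | even c = ≤-trans (≤-reflexive (8k+5₁ b k)) (sign+sign+≤ (1 + b * 2) (suc b) (even≤ c))
  ...     | odd c  = ≤-trans (≤-reflexive (trans (8k+5₁ b k)
                       (cancel (cong -_ (trans (sign-even≡ b c) (sym (neg-involutive _)))) _))) (bound up′ b)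

  lower-8k+5 : ∀ k c {d} → d ≤ s (c * 2) (1 + k * 2) →
               L (1 + (1 + k * 2) * 2 * 2) (sucℤ (sucℤ d))
  lower-8k+5 k c d≤ with ε-unit
  ... | inj₁ ε≡1 = _ , ≤-trans (2+d≤u+v+x (trans (sign-even b) ε≡1) (trans (sign-even c) ε≡1) d≤)
                       (≤-reflexive (sym (8k+5₀ b k)))
    where b = c * 2
  ... | inj₂ ε≡-1 = _ , ≤-trans (2+d≤u+v+x (cong -_ (trans (sign-even b) ε≡-1))
                          (cong -_ (trans (sign-even c) ε≡-1)) d≤)
                        (≤-reflexive (sym (8k+5₁ b k)))
    where b = c * 2

  lower-8k+1 : ∀ k {d} → L (k * 2) d → L (1 + k * 2 * 2 * 2) (sucℤ d)
  lower-8k+1 k low with lower-4k (inj₁ refl) k low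
  ... | a , eq , d≤ = a * 2 , ≤-trans (1+d≤u+x eq d≤) (≤-reflexive (sym (S₀-4k+1 a (k * 2))))

  lower-8k+7 : ∀ k {d} → L (suc k * 2) d → L (1 + (1 + (1 + k * 2) * 2) * 2) (sucℤ d)
  lower-8k+7 k low with lower-4k (inj₂ refl) (suc k) low
  ... | a , eq , d≤ = 1 + a * 2 , ≤-trans (1+d≤u+x (cong -_ eq) d≤) (≤-reflexive (sym (S₁-4k+3 a (1 + k * 2))))

  -- Recurrences for the largest window sum.

  max-4n : ∀ n {d} → IsMax h (n * 2) d → IsMax h (n * 2 * 2) d
  max-4n n (up , low) = upper-4k n up , let a , _ , d≤ = lower-4k ε-unit n low in a , d≤

  max-4n+2 : ∀ n {d} → IsMax h (1 + n * 2) d → IsMax h ((1 + n * 2) * 2) (sucℤ d)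
  max-4n+2 n (up , low) = upper-4k+2 n up , lower-4k+2 n low

  max-16n+1 : ∀ n {d} → IsMax h (1 + n * 2 * 2 * 2) d → IsMax h (1 + n * 2 * 2 * 2 * 2) d
  max-16n+1 n {d} (up , a , d≤) = upper , 1 + a * 2 , ≤-trans d≤ (≤-reflexive (sym (S₁-4k+1 a (n * 2 * 2))))
    where
    -- `lower-8k+1` read backwards: each window of length 2n yields one of length 8n+1 whose sum is
    -- at least 1 larger, and that sum is at most `d`.
    upper-2n : U (n * 2) (predℤ d)
    upper-2n .bound j with lower-8k+1 n (j , ≤-refl)
    ... | i , 1+≤ = subst (_≤ _) (pred-suc _) (pred-mono (≤-trans 1+≤ (bound up i)))
    upper : U (1 + n * 2 * 2 * 2 * 2) d
    upper = subst (U _) (suc-pred d) (upper-4k+1 (n * 2 * 2)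
              (upper-4k (n * 2) (upper-4k n upper-2n)) (subst (U _) (sym (suc-pred d)) up))

  max-16n+5 : ∀ n {d} → IsMax h (1 + n * 2 * 2) d →
              IsMax h (1 + (1 + n * 2 * 2) * 2 * 2) (sucℤ (sucℤ d))
  max-16n+5 n {d} (up , a , d≤) = upper , lower
    where
    upper-8n+3 : U (1 + (1 + n * 2 * 2) * 2) (sucℤ (sucℤ d))
    upper-8n+3 = upper-4k+3 (n * 2) (upper-suc up) (weaken (weaken up))
    upper : U (1 + (1 + n * 2 * 2) * 2 * 2) (sucℤ (sucℤ d))
    upper = upper-4k+1 (1 + n * 2 * 2) (upper-4k+2 (n * 2) up) upper-8n+3
    lower : L (1 + (1 + n * 2 * 2) * 2 * 2) (sucℤ (sucℤ d))
    lower with parity a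
    ... | even b = lower-8k+5 (n * 2) b d≤
    -- The maximum is attained at an even start too: shortening the halved window loses at most 1,
    -- and the sign 1 of `c` restores it.
    ... | odd b with restrict (inj₁ refl) b (n * 2)
    ...   | c , sc , ≤c = lower-8k+5 (n * 2) c (≤-trans d≤ (≤-trans (≤-reflexive (S₁-4k+1 b n))
              (≤-trans ≤c (≤-trans (1+d≤u+x sc ≤-refl) (≤-reflexive (sym (S₀-4k+1 c n)))))))

  max-16n+11 : ∀ n {d} → IsMax h (1 + (1 + n * 2) * 2) d →
               IsMax h (1 + (1 + (1 + n * 2) * 2 * 2) * 2) (sucℤ (sucℤ d))
  max-16n+11 n {d} (up , a , d≤) = upper , lower
    where
    o = 1 + n * 2
    upper : U (1 + (1 + o * 2 * 2) * 2) (sucℤ (sucℤ d))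
    upper = upper-4k+3 (o * 2) (upper-4k+2 o up)
              (upper-4k+1 o (upper-pred up) (weaken (weaken up)))
    lower : L (1 + (1 + o * 2 * 2) * 2) (sucℤ (sucℤ d))
    lower with parity a
    ... | odd c = lower-8k+3 o c d≤
    -- Here an odd start is wanted: lengthening the halved window loses at most 1, and sign -1 at
    -- `c` means sign 1 at `suc c`, which restores it.
    ... | even b with extend (inj₂ refl) b o
    ...   | c , sc , ≤c = lower-8k+3 o c (≤-trans d≤ (≤-trans (≤-reflexive (S₀-4k+3 b n))
              (≤-trans ≤c (≤-trans (1+d≤u+x (cong -_ sc) ≤-refl) (≤-reflexive (sym (S₁-4k+3 c n)))))))

  -- The lengths 2n+2, 4n+4 and 8n+8 all keep the bound `d`, so the lengths one below, up to 16n+15,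
  -- never exceed `sucℤ d`.
  max-16n+15 : ∀ n {d} → IsMax h (suc n * 2) d →
               IsMax h (1 + (1 + (1 + (1 + n * 2) * 2) * 2) * 2) (sucℤ d)
  max-16n+15 n {d} (up , low) = upper , lower
    where
    o = 1 + n * 2
    upper-4n+4 : U (suc o * 2) d
    upper-4n+4 = upper-4k (suc n) up
    upper-8n+7 : U (1 + (1 + o * 2) * 2) (sucℤ d)
    upper-8n+7 = upper-4k+3 o upper-4n+4 (upper-4k+3 n up (upper-pred up))
    upper : U (1 + (1 + (1 + o * 2) * 2) * 2) (sucℤ d)
    upper = upper-4k+3 (1 + o * 2) (upper-4k (suc o) upper-4n+4) upper-8n+7
    lower : L (1 + (1 + (1 + o * 2) * 2) * 2) (sucℤ d)
    lower with lower-4k ε-unit (suc n) low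
    ... | a , _ , d≤ = lower-8k+7 o (a , d≤)

  -- All bounds are relative to the maximum for 2n+1. For 16n+7 and 16n+9 the last halving is a
  -- single one. For 16n+3 and 16n+13 it would pass through 8n+2 or 8n+6, where a sign added to the
  -- bound `sucℤ (sucℤ d)` is too weak; there two halvings are taken together.
  module OddLength (n : ℕ) {d : ℤ} (mx : IsMax h (1 + n * 2) d) where
    private
      o = 1 + n * 2
      up = proj₁ mx
      low = proj₂ mx
      up² : ∀ {m e} → U m e → U m (sucℤ (sucℤ e))
      up² u = weaken (weaken u)

      u-2n : U (n * 2) (sucℤ d)
      u-2n = upper-pred up
      u-2n+2 : U (suc n * 2) (sucℤ d)
      u-2n+2 = upper-suc up
      u-4n+1 : U (1 + n * 2 * 2) (sucℤ (sucℤ d))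
      u-4n+1 = upper-4k+1 n u-2n (up² up)
      u-4n+2 : U (o * 2) (sucℤ d)
      u-4n+2 = upper-4k+2 n up
      u-4n+3 : U (1 + o * 2) (sucℤ (sucℤ d))
      u-4n+3 = upper-4k+3 n u-2n+2 (up² up)
      u-8n+1 : U (1 + n * 2 * 2 * 2) (sucℤ (sucℤ d))
      u-8n+1 = upper-4k+1 (n * 2) (upper-4k n u-2n) u-4n+1
      u-8n+3 : U (1 + (1 + n * 2 * 2) * 2) (sucℤ (sucℤ d))
      u-8n+3 = upper-4k+3 (n * 2) u-4n+2 u-4n+1
      u-8n+4 : U (o * 2 * 2) (sucℤ d)
      u-8n+4 = upper-4k o u-4n+2
      u-8n+5 : U (1 + o * 2 * 2) (sucℤ (sucℤ d))
      u-8n+5 = upper-4k+1 o u-4n+2 u-4n+3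
      u-8n+7 : U (1 + (1 + o * 2) * 2) (sucℤ (sucℤ d))
      u-8n+7 = upper-4k+3 o (upper-4k (suc n) u-2n+2) u-4n+3

    max-16n+3 : IsMax h (1 + (1 + n * 2 * 2 * 2) * 2) (sucℤ (sucℤ d))
    max-16n+3 = upper-8k+3 (n * 2) u-8n+1 u-4n+1
                  -- Odd starts of length 4n+1 halve to length 2n+1 without a sign, so they stay
                  -- below `d` itself, which `u-4n+1` does not give.
                  (λ c → ≤-trans (≤-reflexive (S₁-4k+1 c n)) (bound up c))
              , (let a , d≤ = low in lower-8k+3 (n * 2) a (≤-trans d≤ (≤-reflexive (sym (S₁-4k+1 a n)))))

    max-16n+7 : IsMax h (1 + (1 + (1 + n * 2 * 2) * 2) * 2) (sucℤ (sucℤ d))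
    max-16n+7 = upper-4k+3 (1 + n * 2 * 2) u-8n+4 u-8n+3 , lower-8k+7 (n * 2) (lower-4k+2 n low)

    max-16n+9 : IsMax h (1 + o * 2 * 2 * 2) (sucℤ (sucℤ d))
    max-16n+9 = upper-4k+1 (o * 2) u-8n+4 u-8n+5 , lower-8k+1 o (lower-4k+2 n low)

    max-16n+13 : IsMax h (1 + (1 + o * 2) * 2 * 2) (sucℤ (sucℤ d))
    max-16n+13 = upper-8k+5 o u-8n+7 u-4n+3
                   (λ c → ≤-trans (≤-reflexive (S₀-4k+3 c n)) (bound up c))
               , (let a , d≤ = low in lower-8k+5 o a (≤-trans d≤ (≤-reflexive (sym (S₀-4k+3 a n)))))

-- Iterated `sucℤ`, so that for numeral `k` the type computes to the one in the recurrences for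
-- maxima; `raise≡` recovers addition.
raise : ℕ → ℤ → ℤ
raise zero    d = d
raise (suc k) d = sucℤ (raise k d)

raise≡ : ∀ k d → raise k d ≡ + k ℤ.+ d
raise≡ zero    d = sym (+-identityˡ d)
raise≡ (suc k) d = trans (cong sucℤ (raise≡ k d)) (sym (+-assoc 1ℤ (+ k) d))

IsMax-unique : ∀ {h n d e} → IsMax h n d → IsMax h n e → d ≡ e
IsMax-unique (up , i , d≤) (up′ , j , e≤) = ≤-antisym (≤-trans d≤ (bound up′ i)) (≤-trans e≤ (bound up j))

-- The paperfolding word and its negation as folded sequences.

negate : (ℕ → ℤ) → ℕ → ℤ
negate h j = - h j

alternating-neg : ∀ ε a → alternating (- ε) a ≡ - alternating ε a
alternating-neg ε zero    = refl
alternating-neg ε (suc a) = cong -_ (alternating-neg ε a)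

negate-folded : ∀ {h} → Folded h → Folded (negate h)
negate-folded F = record
  { ε      = - ε
  ; ε-unit = neg-unit ε-unit
  ; h-even = λ a → trans (cong -_ (h-even a)) (sym (alternating-neg ε a))
  ; h-odd  = λ a → cong -_ (h-odd a)
  ; h-unit = λ j → neg-unit (h-unit j)
  }
  where open Folded F

S-negate : ∀ h j n → windowSum (negate h) j n ≡ - windowSum h j n
S-negate h j zero    = refl
S-negate h j (suc n) = trans (cong (λ z → - h j ℤ.+ z) (S-negate h (suc j) n)) (sym (neg-distrib-+ (h j) _))

value : Bit → ℤ
value zero       = 1ℤ
value (suc zero) = -1ℤ

-- Positions start at 0, one less than the index of f, so the even indices are the odd positions.
letter : ℕ → ℤ
letter j = value (f (suc j))

f-odd-suc : ∀ a → f (1 + suc (suc a) * 2) ≡ f (1 + a * 2)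
-- The residues of `5 + a * 2` and `1 + a * 2` modulo 4 agree by computation.
f-odd-suc a = trans (f-odd (5 + a * 2) (is-odd a)) (sym (f-odd (1 + a * 2) (is-odd a)))
  where
  is-odd : ∀ a → (1 + a * 2) % 2 ≡ 1
  is-odd zero    = refl
  is-odd (suc a) = is-odd a

value-unit : ∀ b → IsUnit (value b)
value-unit zero       = inj₁ refl
value-unit (suc zero) = inj₂ refl

letter-folded : Folded letter
letter-folded = record
  { ε      = 1ℤ
  ; ε-unit = inj₁ refl
  ; h-even = h-even
  ; h-odd  = λ a → cong value (f-double (suc a))
  ; h-unit = λ j → value-unit (f (suc j))
  }
  where
  h-even : ∀ a → letter (a * 2) ≡ alternating 1ℤ a
  h-even zero          = refl
  h-even (suc zero)    = refl
  h-even (suc (suc a)) = trans (cong value (f-odd-suc a)) (trans (h-even a) (sym (neg-involutive _)))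

-- Numbers of ones in windows and their intermediate values.

count : ℕ → ℕ → ℕ
count j zero    = 0
count j (suc n) = toℕ (f (suc j)) + count (suc j) n

S+2count : ∀ j n → windowSum letter j n ℤ.+ + 2 ℤ.* + count j n ≡ + n
S+2count j zero    = refl
S+2count j (suc n) = begin
  v ℤ.+ windowSum letter (suc j) n ℤ.+ + 2 ℤ.* (+ b ℤ.+ + count (suc j) n)
    ≡⟨ regroup v (windowSum letter (suc j) n) (+ b) (+ count (suc j) n) ⟩
  v ℤ.+ + 2 ℤ.* + b ℤ.+ (windowSum letter (suc j) n ℤ.+ + 2 ℤ.* + count (suc j) n)
    ≡⟨ cong₂ ℤ._+_ (value+2bit (f (suc j))) (S+2count (suc j) n) ⟩
  + suc n ∎
  where
  open ≡-Reasoning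
  v = letter j
  b = toℕ (f (suc j))
  regroup : ∀ v s b c → v ℤ.+ s ℤ.+ + 2 ℤ.* (b ℤ.+ c) ≡ v ℤ.+ + 2 ℤ.* b ℤ.+ (s ℤ.+ + 2 ℤ.* c)
  regroup = solve-∀
  value+2bit : ∀ b → value b ℤ.+ + 2 ℤ.* + toℕ b ≡ 1ℤ
  value+2bit zero       = refl
  value+2bit (suc zero) = refl

count-snoc : ∀ j n → count j (suc n) ≡ count j n + toℕ (f (suc (j + n)))
count-snoc j zero    rewrite ℕₚ.+-identityʳ j = ℕₚ.+-identityʳ _
count-snoc j (suc n) rewrite ℕₚ.+-suc j n | count-snoc (suc j) n = sym (ℕₚ.+-assoc (toℕ (f (suc j))) _ _)

count-step : ∀ j n → count (suc j) n ℕ.≤ suc (count j n)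
count-step j n = begin
  count (suc j) n                   ≤⟨ ℕₚ.m≤n+m _ _ ⟩
  count j (suc n)                   ≡⟨ count-snoc j n ⟩
  count j n + toℕ (f (suc (j + n))) ≤⟨ ℕₚ.+-monoʳ-≤ (count j n) (Finₚ.toℕ≤pred[n] (f (suc (j + n)))) ⟩
  count j n + 1                     ≡⟨ ℕₚ.+-comm (count j n) 1 ⟩
  suc (count j n)                   ∎
  where open ℕₚ.≤-Reasoning

count-step′ : ∀ j n → count j n ℕ.≤ suc (count (suc j) n)
count-step′ j n = begin
  count j n                         ≤⟨ ℕₚ.m≤m+n _ _ ⟩
  count j n + toℕ (f (suc (j + n))) ≡⟨ count-snoc j n ⟨
  count j (suc n)                   ≤⟨ ℕₚ.+-monoˡ-≤ (count (suc j) n) (Finₚ.toℕ≤pred[n] (f (suc j))) ⟩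
  suc (count (suc j) n)             ∎
  where open ℕₚ.≤-Reasoning

module IntermediateValue (u : ℕ → ℕ) (rise : ∀ i → u (suc i) ℕ.≤ suc (u i))
                         (fall : ∀ i → u i ℕ.≤ suc (u (suc i))) where
  from-below : ∀ i {v} → u i ℕ.≤ v → (∃ λ k → u k ≡ v) ⊎ u 0 ℕ.< v
  from-below i u≤v with ℕₚ.m≤n⇒m<n∨m≡n u≤v
  from-below i       _ | inj₂ eq  = inj₁ (i , eq)
  from-below zero    _ | inj₁ u<v = inj₂ u<v
  from-below (suc i) _ | inj₁ u<v = from-below i (ℕₚ.≤-trans (fall i) u<v)

  from-above : ∀ i {v} → v ℕ.≤ u i → (∃ λ k → u k ≡ v) ⊎ v ℕ.< u 0
  from-above i v≤u with ℕₚ.m≤n⇒m<n∨m≡n v≤u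
  from-above i       _ | inj₂ eq  = inj₁ (i , sym eq)
  from-above zero    _ | inj₁ v<u = inj₂ v<u
  from-above (suc i) _ | inj₁ v<u = from-above i (ℕ.s≤s⁻¹ (ℕₚ.≤-trans v<u (rise i)))

  -- To avoid comparing `i` with `j`, both walks descend to index 0. If neither meets `v`, then
  -- `u 0` lies strictly on both sides of `v`.
  attained : ∀ i j {v} → u i ℕ.≤ v → v ℕ.≤ u j → ∃ λ k → u k ≡ v
  attained i j u≤v v≤u with from-below i u≤v | from-above j v≤u
  ... | inj₁ hit | _        = hit
  ... | inj₂ _   | inj₁ hit = hit
  ... | inj₂ u<v | inj₂ v<u = contradiction u<v (ℕₚ.<-asym v<u)

-- Abelian classes as numbers of ones.

ones zeros : List Bit → ℕ
ones w  = sum (map toℕ w)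
zeros w = sum (map (toℕ ∘ Fin.opposite) w)

zeros+ones : ∀ w → zeros w + ones w ≡ length w
zeros+ones []               = refl
zeros+ones (zero ∷ w)       = cong suc (zeros+ones w)
zeros+ones (suc zero ∷ w)   = trans (ℕₚ.+-suc (zeros w) (ones w)) (cong suc (zeros+ones w))

sorted : ℕ → ℕ → List Bit
sorted z o = replicate o 1b ++ replicate z 0b

↭-sorted : ∀ w → w ↭ sorted (zeros w) (ones w)
↭-sorted []             = ↭-refl
↭-sorted (zero ∷ w)     = ↭-trans (↭-prep 0b (↭-sorted w)) (↭-sym (shift 0b (replicate (ones w) 1b) _))
↭-sorted (suc zero ∷ w) = ↭-prep 1b (↭-sorted w)

-- The length fixes the number of zeros, so both words rearrange to the same `sorted` word.
ones⇒↭ : ∀ u v → length u ≡ length v → ones u ≡ ones v → u ↭ v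
ones⇒↭ u v |u|≡|v| ones≡ = ↭-trans (↭-sorted u)
  (↭-trans (↭-reflexive (cong₂ sorted zeros≡ ones≡)) (↭-sym (↭-sorted v)))
  where
  zeros≡ : zeros u ≡ zeros v
  zeros≡ = ℕₚ.+-cancelʳ-≡ (ones u) _ _ (trans (zeros+ones u) (trans |u|≡|v|
             (trans (sym (zeros+ones v)) (cong (_+_ (zeros v)) (sym ones≡)))))

ones-resp-↭ : ∀ {u v} → u ↭ v → ones u ≡ ones v
ones-resp-↭ u↭v = sum-↭ (map⁺ toℕ u↭v)

ones-factor : ∀ j n → ones (factor (suc j) n) ≡ count j n
ones-factor j n = go _ j n (λ k → refl)
  where
  -- Generalised over `g` because `applyUpTo` recurses on `g ∘ suc`, which matches the shifted
  -- window only pointwise.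
  go : ∀ g j n → (∀ k → g k ≡ f (suc (j + k))) → ones (applyUpTo g n) ≡ count j n
  go g j zero    eq = refl
  go g j (suc n) eq = cong₂ _+_ (cong toℕ (trans (eq 0) (cong (f ∘ suc) (ℕₚ.+-identityʳ j))))
    (go (g ∘ suc) (suc j) n (λ k → trans (eq (suc k)) (cong (f ∘ suc) (ℕₚ.+-suc j k))))

window : ∀ n → ℕ → Factor n
window n j = factor (suc j) n , suc j , ℕ.s≤s ℕ.z≤n , refl

start : ∀ {n} → Factor n → ℕ
start (_ , i , _) = ℕ.pred i

ones-start : ∀ {n} (x : Factor n) → ones (proj₁ x) ≡ count (start x) n
ones-start {n} (_ , suc j , _ , refl) = ones-factor j n

length-Factor : ∀ {n} (x : Factor n) → length (proj₁ x) ≡ n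
length-Factor {n} (_ , i , _ , refl) = length-applyUpTo (λ j → f (i + j)) n

-- Composing the two gives a bijection between finite sets. As `ρ` rests on an abstract definition,
-- its values are reached through this uniqueness.
HasClasses-unique : ∀ {A k l} → HasClasses A k → HasClasses A l → k ≡ l
HasClasses-unique I J = ↔⇒≡ (Compose.inverse (Symmetry.inverse I) J)

module Extremes {n} (i₀ i₁ : ℕ) (least : ∀ j → count i₀ n ℕ.≤ count j n)
                (greatest : ∀ j → count j n ℕ.≤ count i₁ n) where
  private
    lo = count i₀ n
    hi = count i₁ n
    open IntermediateValue (λ j → count j n) (λ j → count-step j n) (λ j → count-step′ j n)

  offset : Factor n → ℕ
  offset x = ones (proj₁ x) ℕ.∸ lo

  offset< : ∀ x → offset x ℕ.< suc (hi ℕ.∸ lo)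
  offset< x = ℕ.s≤s (ℕₚ.∸-monoˡ-≤ lo (subst (ℕ._≤ hi) (sym (ones-start x)) (greatest (start x))))

  lo+offset : ∀ x → lo + offset x ≡ ones (proj₁ x)
  lo+offset x = ℕₚ.m+[n∸m]≡n (subst (lo ℕ.≤_) (sym (ones-start x)) (least (start x)))

  realise : (t : Fin (suc (hi ℕ.∸ lo))) → ∃ λ k → count k n ≡ lo + toℕ t
  realise t = attained i₀ i₁ (ℕₚ.m≤m+n lo (toℕ t))
    (ℕₚ.≤-trans (ℕₚ.+-monoʳ-≤ lo (Finₚ.toℕ≤pred[n] t)) (ℕₚ.≤-reflexive (ℕₚ.m+[n∸m]≡n (least i₁))))

  ones-realise : ∀ t → ones (factor (suc (proj₁ (realise t))) n) ≡ lo + toℕ t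
  ones-realise t = trans (ones-factor _ n) (proj₂ (realise t))

  classes : HasClasses (AbelianFactors n) (suc (hi ℕ.∸ lo))
  classes = record
    { to        = λ x → fromℕ< (offset< x)
    ; from      = λ t → window n (proj₁ (realise t))
    ; to-cong   = λ {x} {y} x↭y → Finₚ.fromℕ<-cong _ _ (cong (ℕ._∸ lo) (ones-resp-↭ x↭y)) (offset< x) (offset< y)
    ; from-cong = λ { refl → ↭-refl }
    ; inverse   = (λ {t} {x} x↭t → Finₚ.toℕ-injective (trans (Finₚ.toℕ-fromℕ< (offset< x))
                    (ℕₚ.+-cancelˡ-≡ lo _ _ (trans (lo+offset x) (trans (ones-resp-↭ x↭t) (ones-realise t))))))
                , (λ { {x} refl → let t = fromℕ< (offset< x) in ones⇒↭ _ _
                    (trans (length-Factor (window n (proj₁ (realise t)))) (sym (length-Factor x)))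
                    (trans (ones-realise t) (trans (cong (_+_ lo) (Finₚ.toℕ-fromℕ< (offset< x))) (lo+offset x))) })
    }

  ρ≡ : ρ n ≡ suc (hi ℕ.∸ lo)
  ρ≡ = HasClasses-unique {AbelianFactors n} (ρ-classes n) classes

module _ (n : ℕ) where
  private
    open Inverse (ρ-classes n)
    weight : Fin (ρ n) → ℕ
    weight t = ones (proj₁ (from t))

    weight-to : ∀ j → weight (to (window n j)) ≡ count j n
    weight-to j = trans (ones-resp-↭ (proj₂ inverse {window n j} refl)) (ones-factor j n)

    weight≡ : ∀ t → weight t ≡ count (start (from t)) n
    weight≡ t = ones-start (from t)

    -- The default needed by `argmin` and `argmax`: the class of the first window.
    t₀ : Fin (ρ n)
    t₀ = to (window n 0)

  -- Infinitely many starts are reduced to finitely many: the number of ones depends only on the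
  -- class, so it is minimised over `Fin (ρ n)`.
  least-count : ∃ λ i → ∀ j → count i n ℕ.≤ count j n
  least-count = start (from t) , λ j → subst₂ ℕ._≤_ (weight≡ t) (weight-to j)
      (All.lookup (Extrema.f[argmin]≤f[xs] {f = weight} t₀ (allFin _)) (∈-allFin (to (window n j))))
    where t = Extrema.argmin weight t₀ (allFin _)

  greatest-count : ∃ λ i → ∀ j → count j n ℕ.≤ count i n
  greatest-count = start (from t) , λ j → subst₂ ℕ._≤_ (weight-to j) (weight≡ t)
      (All.lookup (Extrema.f[xs]≤f[argmax] {f = weight} t₀ (allFin _)) (∈-allFin (to (window n j))))
    where t = Extrema.argmax weight t₀ (allFin _)

-- From largest window sums to the complexity.

S≡n-2count : ∀ j n → windowSum letter j n ≡ + n ℤ.+ - (+ 2 ℤ.* + count j n)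
S≡n-2count j n = trans (add-sub (windowSum letter j n) (+ 2 ℤ.* + count j n))
                   (cong (ℤ._+ - (+ 2 ℤ.* + count j n)) (S+2count j n))
  where
  add-sub : ∀ x y → x ≡ x ℤ.+ y ℤ.+ - y
  add-sub = solve-∀

S-anti : ∀ {i j} n → count i n ℕ.≤ count j n → windowSum letter j n ≤ windowSum letter i n
S-anti {i} {j} n i≤j = subst₂ _≤_ (sym (S≡n-2count j n)) (sym (S≡n-2count i n))
  (+-monoʳ-≤ (+ n) (neg-mono-≤ (*-monoˡ-≤-nonNeg (+ 2) (ℤ.+≤+ i≤j))))

-- With least count `lo` and greatest count `hi`, `d` is n - 2 `lo` and `e` is 2 `hi` - n, so their
-- sum is twice `hi` - `lo`.
Amplitude : ℕ → Set
Amplitude n = ∃₂ λ d e → IsMax letter n d × IsMax (negate letter) n e × + 2 ℤ.* + ρ n ≡ + 2 ℤ.+ (d ℤ.+ e)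

amplitude : ∀ n → Amplitude n
amplitude n = windowSum letter i₀ n , windowSum (negate letter) i₁ n
  , (record { bound = λ j → S-anti n (least j) } , i₀ , ≤-refl)
  , (record { bound = λ j → subst₂ _≤_ (sym (S-negate letter j n)) (sym (S-negate letter i₁ n))
                              (neg-mono-≤ (S-anti n (greatest j))) } , i₁ , ≤-refl)
  , formula
  where
  i₀ = proj₁ (least-count n)
  i₁ = proj₁ (greatest-count n)
  least = proj₂ (least-count n)
  greatest = proj₂ (greatest-count n)
  lo = count i₀ n
  hi = count i₁ n
  arith : ∀ N l k → + 2 ℤ.* (1ℤ ℤ.+ k) ≡ + 2 ℤ.+ (N ℤ.+ - (+ 2 ℤ.* l) ℤ.+ - (N ℤ.+ - (+ 2 ℤ.* (l ℤ.+ k))))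
  arith = solve-∀
  formula : + 2 ℤ.* + ρ n ≡ + 2 ℤ.+ (windowSum letter i₀ n ℤ.+ windowSum (negate letter) i₁ n)
  formula = begin
    + 2 ℤ.* + ρ n
      ≡⟨ cong (λ r → + 2 ℤ.* + r) (Extremes.ρ≡ i₀ i₁ least greatest) ⟩
    + 2 ℤ.* (1ℤ ℤ.+ + (hi ℕ.∸ lo))
      ≡⟨ arith (+ n) (+ lo) (+ (hi ℕ.∸ lo)) ⟩
    + 2 ℤ.+ (+ n ℤ.+ - (+ 2 ℤ.* + lo) ℤ.+ - (+ n ℤ.+ - (+ 2 ℤ.* + (lo + (hi ℕ.∸ lo)))))
      ≡⟨ cong (λ m → + 2 ℤ.+ (+ n ℤ.+ - (+ 2 ℤ.* + lo) ℤ.+ - (+ n ℤ.+ - (+ 2 ℤ.* + m)))) (ℕₚ.m+[n∸m]≡n (least i₁)) ⟩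
    + 2 ℤ.+ (+ n ℤ.+ - (+ 2 ℤ.* + lo) ℤ.+ - (+ n ℤ.+ - (+ 2 ℤ.* + hi)))
      ≡⟨ cong₂ (λ x y → + 2 ℤ.+ (x ℤ.+ - y)) (S≡n-2count i₀ n) (S≡n-2count i₁ n) ⟨
    + 2 ℤ.+ (windowSum letter i₀ n ℤ.+ - windowSum letter i₁ n)
      ≡⟨ cong (λ y → + 2 ℤ.+ (windowSum letter i₀ n ℤ.+ y)) (S-negate letter i₁ n) ⟨
    + 2 ℤ.+ (windowSum letter i₀ n ℤ.+ windowSum (negate letter) i₁ n) ∎
    where open ≡-Reasoning

-- Applying `grow` to the word and to its negation raises both maxima by `k`, hence 2ρ by 2`k`.
ρ-shift : ∀ {m n} k → (∀ {h} → Folded h → ∀ {d} → IsMax h m d → IsMax h n (raise k d)) →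
          ρ n ≡ ρ m + k
ρ-shift {m} {n} k grow = compare (amplitude m) (amplitude n)
  where
  regroup : ∀ k d e → + 2 ℤ.+ ((k ℤ.+ d) ℤ.+ (k ℤ.+ e)) ≡ + 2 ℤ.+ (d ℤ.+ e) ℤ.+ + 2 ℤ.* k
  regroup = solve-∀
  compare : Amplitude m → Amplitude n → ρ n ≡ ρ m + k
  compare (d , e , max-d , max-e , 2ρm) (d′ , e′ , max-d′ , max-e′ , 2ρn) =
    +-injective (*-cancelˡ-≡ (+ 2) (+ ρ n) (+ (ρ m + k)) (begin
      + 2 ℤ.* + ρ n                         ≡⟨ 2ρn ⟩
      + 2 ℤ.+ (d′ ℤ.+ e′)                   ≡⟨ cong₂ (λ x y → + 2 ℤ.+ (x ℤ.+ y)) d′≡ e′≡ ⟩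
      + 2 ℤ.+ ((+ k ℤ.+ d) ℤ.+ (+ k ℤ.+ e)) ≡⟨ regroup (+ k) d e ⟩
      + 2 ℤ.+ (d ℤ.+ e) ℤ.+ + 2 ℤ.* + k     ≡⟨ cong (ℤ._+ + 2 ℤ.* + k) 2ρm ⟨
      + 2 ℤ.* + ρ m ℤ.+ + 2 ℤ.* + k         ≡⟨ *-distribˡ-+ (+ 2) (+ ρ m) (+ k) ⟨
      + 2 ℤ.* + (ρ m + k)                   ∎))
    where
    open ≡-Reasoning
    d′≡ : d′ ≡ + k ℤ.+ d
    d′≡ = trans (IsMax-unique {letter} {n} max-d′ (grow {letter} letter-folded max-d)) (raise≡ k d)
    e′≡ : e′ ≡ + k ℤ.+ e
    e′≡ = trans (IsMax-unique {negate letter} {n} max-e′ (grow {negate letter} (negate-folded letter-folded) max-e)) (raise≡ k e)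

-- The equations carry lengths from polynomial form to the nested form used for halving.
ρ-recurrence : ∀ {m n m′ n′} k → m ≡ m′ → n ≡ n′ →
  (∀ {h} → Folded h → ∀ {d} → IsMax h m′ d → IsMax h n′ (raise k d)) → ρ n ≡ ρ m + k
ρ-recurrence k refl refl = ρ-shift k

theorem2 : (∀ n → n ≥ 1 → ρ (4 * n) ≡ ρ (2 * n))
    × (∀ n → ρ (4 * n + 2) ≡ ρ (2 * n + 1) + 1)
    × (∀ n → ρ (16 * n + 1) ≡ ρ (8 * n + 1))
    × (∀ n c → c ∈ 3 ∷ 7 ∷ 9 ∷ 13 ∷ [] → ρ (16 * n + c) ≡ ρ (2 * n + 1) + 2)
    × (∀ n → ρ (16 * n + 5) ≡ ρ (4 * n + 1) + 2)
    × (∀ n → ρ (16 * n + 11) ≡ ρ (4 * n + 3) + 2)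
    × (∀ n → ρ (16 * n + 15) ≡ ρ (2 * n + 2) + 1)
theorem2 =
    (λ n _ → trans (ρ-recurrence 0 (2n n) (4n n) (λ F → max-4n F n)) (ℕₚ.+-identityʳ _))
  , (λ n → ρ-recurrence 1 (2n+1 n) (4n+2 n) (λ F → max-4n+2 F n))
  , (λ n → trans (ρ-recurrence 0 (8n+1 n) (16n+1 n) (λ F → max-16n+1 F n)) (ℕₚ.+-identityʳ _))
  , (λ { n _ (here refl)                         → ρ-recurrence 2 (2n+1 n) (16n+3 n) (λ F → OddLength.max-16n+3 F n)
       ; n _ (there (here refl))                 → ρ-recurrence 2 (2n+1 n) (16n+7 n) (λ F → OddLength.max-16n+7 F n)
       ; n _ (there (there (here refl)))         → ρ-recurrence 2 (2n+1 n) (16n+9 n) (λ F → OddLength.max-16n+9 F n)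
       ; n _ (there (there (there (here refl)))) → ρ-recurrence 2 (2n+1 n) (16n+13 n) (λ F → OddLength.max-16n+13 F n)
       })
  , (λ n → ρ-recurrence 2 (4n+1 n) (16n+5 n) (λ F → max-16n+5 F n))
  , (λ n → ρ-recurrence 2 (4n+3 n) (16n+11 n) (λ F → max-16n+11 F n))
  , (λ n → ρ-recurrence 1 (2n+2 n) (16n+15 n) (λ F → max-16n+15 F n))
  where
  open ℕ-Solver using () renaming (solve-∀ to solve-ℕ)
  2n : ∀ n → 2 * n ≡ n * 2
  2n = solve-ℕ
  2n+1 : ∀ n → 2 * n + 1 ≡ 1 + n * 2
  2n+1 = solve-ℕ
  2n+2 : ∀ n → 2 * n + 2 ≡ suc n * 2
  2n+2 = solve-ℕ
  4n : ∀ n → 4 * n ≡ n * 2 * 2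
  4n = solve-ℕ
  4n+1 : ∀ n → 4 * n + 1 ≡ 1 + n * 2 * 2
  4n+1 = solve-ℕ
  4n+2 : ∀ n → 4 * n + 2 ≡ (1 + n * 2) * 2
  4n+2 = solve-ℕ
  4n+3 : ∀ n → 4 * n + 3 ≡ 1 + (1 + n * 2) * 2
  4n+3 = solve-ℕ
  8n+1 : ∀ n → 8 * n + 1 ≡ 1 + n * 2 * 2 * 2
  8n+1 = solve-ℕ
  16n+1 : ∀ n → 16 * n + 1 ≡ 1 + n * 2 * 2 * 2 * 2
  16n+1 = solve-ℕ
  16n+3 : ∀ n → 16 * n + 3 ≡ 1 + (1 + n * 2 * 2 * 2) * 2
  16n+3 = solve-ℕ
  16n+5 : ∀ n → 16 * n + 5 ≡ 1 + (1 + n * 2 * 2) * 2 * 2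
  16n+5 = solve-ℕ
  16n+7 : ∀ n → 16 * n + 7 ≡ 1 + (1 + (1 + n * 2 * 2) * 2) * 2
  16n+7 = solve-ℕ
  16n+9 : ∀ n → 16 * n + 9 ≡ 1 + (1 + n * 2) * 2 * 2 * 2
  16n+9 = solve-ℕ
  16n+11 : ∀ n → 16 * n + 11 ≡ 1 + (1 + (1 + n * 2) * 2 * 2) * 2
  16n+11 = solve-ℕ
  16n+13 : ∀ n → 16 * n + 13 ≡ 1 + (1 + (1 + n * 2) * 2) * 2 * 2
  16n+13 = solve-ℕ
  16n+15 : ∀ n → 16 * n + 15 ≡ 1 + (1 + (1 + (1 + n * 2) * 2) * 2) * 2
  16n+15 = solve-ℕ
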